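{- Let $n\geq 5$ and let $Q_n$ be the $n$-dimensional hypercube. Then $$\rho'(Q_n)\leq \frac{\lceil \log_2 n\rceil+4}{2}\,\bigl(\lceil \log_2 n\rceil+1\bigr).$$
   Context: The hypercube $Q_n$ is the Cartesian product of $n$ copies of $K_2$. An edge coloring of a graph is distinguishing if no automorphism other than the identity preserves it. $D'(G)$ is the least number of colors in a distinguishing edge coloring of $G$. When $D'(G)=2$, the cost of edge-distinguishing $\rho'(G)$ is the minimum number of edges in the smaller color class over all distinguishing edge colorings of $G$ with two colors. -}

module Defs where

open import Data.Fin.Base using (Fin; zero; suc)
import Data.Fin.Properties as Fin
open import Data.List.Base
  using (List; []; _∷_; _++_; map; filter; length; allFin; cartesianProduct)
open import Data.List.Membership.Propositional using (_∈_)
open import Data.List.Membership.Propositional.Properties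
  using (∈-allFin; ∈-cartesianProduct⁺)
open import Data.List.Relation.Unary.Unique.Propositional using (Unique)
open import Data.List.Relation.Unary.Unique.Propositional.Properties
  using (allFin⁺; cartesianProduct⁺)
open import Data.Nat.Base using (ℕ; zero; suc; _≤_; _⊓_)
open import Data.Product.Base using (_×_; _,_; Σ-syntax)
open import Data.Product.Properties using (≡-dec)
open import Data.Sum.Base using (_⊎_; inj₁; inj₂)
open import Function.Bundles using (_↔_; _⇔_; Inverse)
open import Relation.Binary.Definitions
  using (Decidable; DecidableEquality; Symmetric)
open import Relation.Binary.PropositionalEquality using (_≡_; _≢_; refl; sym)
open import Relation.Nullary.Decidable using (¬?; _×-dec_; _⊎-dec_)
open import Relation.Nullary.Negation using (¬_)

-- Finite simple graphs; `vertices` lists every vertex exactly once.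
record Graph : Set₁ where
  field
    V        : Set
    Adj      : V → V → Set
    adj-sym  : Symmetric Adj
    adj-irr  : ∀ {v} → ¬ Adj v v
    _≟ᵛ_     : DecidableEquality V
    adj?     : Decidable Adj
    vertices : List V
    complete : ∀ v → v ∈ vertices
    unique   : Unique vertices

open Graph using (V; Adj)

K : ℕ → Graph
K m = record
  { V        = Fin m
  ; Adj      = _≢_
  ; adj-sym  = λ u≢v v≡u → u≢v (sym v≡u)
  ; adj-irr  = λ v≢v → v≢v refl
  ; _≟ᵛ_     = Fin._≟_
  ; adj?     = λ u v → ¬? (u Fin.≟ v)
  ; vertices = allFin m
  ; complete = ∈-allFin
  ; unique   = allFin⁺ m
  }

infixr 7 _□_

-- Cartesian product of graphs.
_□_ : Graph → Graph → Graph
G □ H = record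
  { V        = G.V × H.V
  ; Adj      = λ (a , x) (b , y) → (a ≡ b × H.Adj x y) ⊎ (G.Adj a b × x ≡ y)
  ; adj-sym  = λ { (inj₁ (p , e)) → inj₁ (sym p , H.adj-sym e)
                 ; (inj₂ (e , p)) → inj₂ (G.adj-sym e , sym p) }
  ; adj-irr  = λ { (inj₁ (_ , e)) → H.adj-irr e
                 ; (inj₂ (e , _)) → G.adj-irr e }
  ; _≟ᵛ_     = ≡-dec G._≟ᵛ_ H._≟ᵛ_
  ; adj?     = λ (a , x) (b , y) →
                 ((a G.≟ᵛ b) ×-dec H.adj? x y) ⊎-dec (G.adj? a b ×-dec (x H.≟ᵛ y))
  ; vertices = cartesianProduct G.vertices H.vertices
  ; complete = λ (a , x) → ∈-cartesianProduct⁺ (G.complete a) (H.complete x)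
  ; unique   = cartesianProduct⁺ G.unique H.unique
  }
  where
  module G = Graph G
  module H = Graph H

-- The product of n copies of K 2; the empty product is the one-vertex graph.
Q : ℕ → Graph
Q zero    = K 1
Q (suc n) = K 2 □ Q n

-- All pairs (x , y) with x at an earlier position than y.
pairs : {A : Set} → List A → List (A × A)
pairs []       = []
pairs (x ∷ xs) = map (x ,_) xs ++ pairs xs

-- Each edge appears exactly once, in one of its two orientations.
edges : (G : Graph) → List (V G × V G)
edges G = filter (λ (u , v) → Graph.adj? G u v) (pairs (Graph.vertices G))

record Automorphism (G : Graph) : Set where
  field
    bijection : V G ↔ V G

  open Inverse bijection public using (to; from)

  field
    preserves-adj : ∀ u v → Adj G u v ⇔ Adj G (to u) (to v)

-- An edge coloring is a symmetric function on ordered pairs of adjacent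
-- vertices; its values on non-adjacent pairs are never inspected.
record EdgeColoring (G : Graph) (k : ℕ) : Set where
  field
    color     : V G → V G → Fin k
    color-sym : ∀ {u v} → Adj G u v → color u v ≡ color v u

module _ {G : Graph} where

  Preserves : ∀ {k} → Automorphism G → EdgeColoring G k → Set
  Preserves f c = ∀ {u v} → Adj G u v → color (to u) (to v) ≡ color u v
    where
    open Automorphism f
    open EdgeColoring c

  Distinguishing : ∀ {k} → EdgeColoring G k → Set
  Distinguishing c =
    ∀ (f : Automorphism G) → Preserves f c → ∀ v → Automorphism.to f v ≡ v

  classSize : ∀ {k} → EdgeColoring G k → Fin k → ℕ
  classSize c i =
    length (filter (λ (u , v) → EdgeColoring.color c u v Fin.≟ i) (edges G))

  smallerClassSize : EdgeColoring G 2 → ℕ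
  smallerClassSize c = classSize c zero ⊓ classSize c (suc zero)

IsLeast : (ℕ → Set) → ℕ → Set
IsLeast P k = P k × (∀ m → P m → k ≤ m)

-- "D′(G) = k".
IsDistinguishingIndex : Graph → ℕ → Set
IsDistinguishingIndex G = IsLeast λ k → Σ[ c ∈ EdgeColoring G k ] Distinguishing c

-- "ρ′(G) = k", which is meaningful only when D′(G) = 2.
record IsCost (G : Graph) (k : ℕ) : Set where
  field
    index≡2 : IsDistinguishingIndex G 2
    minimum : IsLeast
      (λ m → Σ[ c ∈ EdgeColoring G 2 ] (Distinguishing c × smallerClassSize c ≡ m))
      k

{-# OPTIONS --safe #-}
module Submission where

-- Let L = ⌈log₂ n⌉. The red edges are a path chain 0, …, chain (2 + L) along the
-- coordinates 0, …, 1 + L, starting at the origin, two further edges at the origin, and one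
-- edge at each of L vertices row 0, …, row (L - 1): 2 L + 4 edges in all. The origin is the
-- only vertex of red degree 3, so an automorphism preserving the colors fixes it, hence
-- preserves levels and the upward direction of red edges; it therefore fixes the path, hence
-- the first 2 + L coordinates of every vertex. These coordinates tell the rows apart, so the
-- rows are fixed as well, and on the other coordinates row j is the j-th binary digit of the
-- index. Thus no two coordinates agree on all fixed vertices, the neighbours of the origin
-- are fixed, and an isometry fixing the origin and its neighbours is the identity. That the
-- minimum exists constructively is a finite search.
open import Defs
open import Data.Bool.Base using (Bool; true; false; not; if_then_else_)
open import Data.Bool.Properties using (¬-not; not-¬)
import Data.Bool.Properties as Bool
open import Data.Fin.Base using (Fin; zero; suc; opposite; finToFun; funToFin)
import Data.Fin.Base as Fin using (_<_)
import Data.Fin.Properties as Fin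
open import Data.List.Base using (List; []; _∷_; _++_; length; lookup; map; upTo)
open import Data.List.Membership.Propositional using (_∈_)
import Data.List.Membership.DecPropositional as DecMembership
open import Data.List.Membership.Propositional.Properties
  using (∈-map⁺; ∈-map⁻; ∈-++⁺ˡ; ∈-++⁺ʳ; ∈-++⁻; ∈-filter⁻; ∈-lookup; ∈-upTo⁺; ∈-upTo⁻)
open import Data.List.Properties using (filter-≐; length-++; length-map; length-upTo)
open import Data.List.Relation.Unary.All as All using (All; []; _∷_)
import Data.List.Relation.Unary.All.Properties as All
open import Data.List.Relation.Unary.AllPairs using (AllPairs; []; _∷_)
import Data.List.Relation.Unary.AllPairs.Properties as AllPairs
open import Data.List.Relation.Unary.Any using (here; there; index)
open import Data.List.Relation.Unary.Any.Properties using (lookup-index)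
open import Data.List.Relation.Unary.Unique.Propositional using (Unique)
open import Data.Nat.Base
open import Data.Nat.Induction using (Acc; acc; <-wellFounded)
open import Data.Nat.Logarithm using (⌈log₂_⌉; ⌈log₂⌉-mono-≤; ⌈log₂2^n⌉≡n)
open import Data.Nat.Logarithm.Core using (⌈log2⌉)
open import Data.Nat.Properties
open import Data.Nat.Solver using (module +-*-Solver)
open import Data.Product.Base using (Σ-syntax; _×_; _,_; ∃; ∃-syntax; proj₁; proj₂; swap)
open import Data.Product.Properties using (≡-dec)
open import Data.Sum.Base using (_⊎_; inj₁; inj₂)
import Data.Sum.Base as Sum
open import Function.Base using (_∘_; id)
open import Function.Bundles using (Equivalence; Inverse; mk⇔; mk↔ₛ′)
open import Relation.Binary.Definitions using (tri<; tri≈; tri>)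
open import Relation.Binary.PropositionalEquality
open import Relation.Nullary.Decidable
  using (Dec; yes; no; does; dec-true; dec-false; does-⇔; decidable-stable; map′; ¬?; _×-dec_; _→-dec_; _⊎-dec_)
open import Relation.Nullary.Negation using (¬_; contradiction)
import Relation.Unary as U

open Graph using (V; Adj)
open EdgeColoring using (color)

-- Coordinates of hypercube vertices, and adjacency as the flip of one bit.

toBit : Bool → Fin 2
toBit false = zero
toBit true  = suc zero

isOne : Fin 2 → Bool
isOne zero    = false
isOne (suc _) = true

isOne-toBit : ∀ b → isOne (toBit b) ≡ b
isOne-toBit false = refl
isOne-toBit true  = refl

isOne-injective : ∀ a b → isOne a ≡ isOne b → a ≡ b
isOne-injective zero       zero       _ = refl
isOne-injective (suc zero) (suc zero) _ = refl

isOne-opposite : ∀ a → isOne (opposite a) ≡ not (isOne a)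
isOne-opposite zero       = refl
isOne-opposite (suc zero) = refl

a≢opposite-a : ∀ (a : Fin 2) → a ≢ opposite a
a≢opposite-a zero       ()
a≢opposite-a (suc zero) ()

opposite₂-involutive : ∀ (a : Fin 2) → opposite (opposite a) ≡ a
opposite₂-involutive zero       = refl
opposite₂-involutive (suc zero) = refl

≢⇒opposite : ∀ {a b : Fin 2} → a ≢ b → b ≡ opposite a
≢⇒opposite {zero}     {zero}     a≢b = contradiction refl a≢b
≢⇒opposite {zero}     {suc zero} _   = refl
≢⇒opposite {suc zero} {zero}     _   = refl
≢⇒opposite {suc zero} {suc zero} a≢b = contradiction refl a≢b

-- A bit index beyond the dimension reads as false, and flipping it changes nothing.
bit : ∀ n → V (Q n) → ℕ → Bool
bit zero    _       _       = false
bit (suc n) (a , _) zero    = isOne a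
bit (suc n) (_ , x) (suc i) = bit n x i

vertex : ∀ n → (ℕ → Bool) → V (Q n)
vertex zero    _ = zero
vertex (suc n) p = toBit (p 0) , vertex n (p ∘ suc)

flip : ∀ n → ℕ → V (Q n) → V (Q n)
flip zero    _       x       = x
flip (suc n) zero    (a , x) = opposite a , x
flip (suc n) (suc i) (a , x) = a , flip n i x

bit-vertex : ∀ n p {i} → i < n → bit n (vertex n p) i ≡ p i
bit-vertex (suc n) p {zero}  _         = isOne-toBit (p 0)
bit-vertex (suc n) p {suc i} (s≤s i<n) = bit-vertex n (p ∘ suc) i<n

bit-injective : ∀ n {x y} → (∀ i → i < n → bit n x i ≡ bit n y i) → x ≡ y
bit-injective zero    {zero}  {zero}  _  = refl
bit-injective (suc n) {a , _} {b , _} eq =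
  cong₂ _,_ (isOne-injective a b (eq 0 z<s)) (bit-injective n (λ i i<n → eq (suc i) (s<s i<n)))

bit-flip : ∀ n i x → i < n → bit n (flip n i x) i ≡ not (bit n x i)
bit-flip (suc n) zero    (a , _) _         = isOne-opposite a
bit-flip (suc n) (suc i) (_ , x) (s≤s i<n) = bit-flip n i x i<n

bit-flip-other : ∀ n i x j → i ≢ j → bit n (flip n i x) j ≡ bit n x j
bit-flip-other zero    i       x j       i≢j = refl
bit-flip-other (suc n) zero    x zero    i≢j = contradiction refl i≢j
bit-flip-other (suc n) zero    x (suc j) i≢j = refl
bit-flip-other (suc n) (suc i) x zero    i≢j = refl
bit-flip-other (suc n) (suc i) (_ , x) (suc j) i≢j = bit-flip-other n i x j (i≢j ∘ cong suc)

flip-involutive : ∀ n i x → flip n i (flip n i x) ≡ x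
flip-involutive zero    i       x       = refl
flip-involutive (suc n) zero    (a , x) = cong (_, x) (opposite₂-involutive a)
flip-involutive (suc n) (suc i) (a , x) = cong (a ,_) (flip-involutive n i x)

flip-injective : ∀ n i {x y} → flip n i x ≡ flip n i y → x ≡ y
flip-injective n i {x} {y} eq =
  trans (sym (flip-involutive n i x)) (trans (cong (flip n i) eq) (flip-involutive n i y))

Adj⇒flip : ∀ n {x y} → Adj (Q n) x y → ∃[ i ] (i < n × y ≡ flip n i x)
Adj⇒flip zero    {zero} {zero} x≢y = contradiction refl x≢y
Adj⇒flip (suc n) (inj₁ (refl , e)) with Adj⇒flip n e
... | i , i<n , eq = suc i , s<s i<n , cong (_ ,_) eq
Adj⇒flip (suc n) (inj₂ (a≢b , refl)) = 0 , z<s , cong (_, _) (≢⇒opposite a≢b)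

flip-Adj : ∀ n i x → i < n → Adj (Q n) x (flip n i x)
flip-Adj (suc n) zero    (a , x) _         = inj₂ (a≢opposite-a a , refl)
flip-Adj (suc n) (suc i) (a , x) (s≤s i<n) = inj₁ (refl , flip-Adj n i x i<n)

-- Hamming distance.

δ : Bool → Bool → ℕ
δ false b = if b then 1 else 0
δ true  b = if b then 0 else 1

δ-not-agree : ∀ a b → a ≡ b → δ a (not b) ≡ suc (δ a b)
δ-not-agree false .false refl = refl
δ-not-agree true  .true  refl = refl

δ-not-differ : ∀ a b → a ≢ b → suc (δ a (not b)) ≡ δ a b
δ-not-differ false false a≢b = contradiction refl a≢b
δ-not-differ false true  _   = refl
δ-not-differ true  false _   = refl
δ-not-differ true  true  a≢b = contradiction refl a≢b

dist : ∀ n → V (Q n) → V (Q n) → ℕ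
dist zero    _       _       = 0
dist (suc n) (a , x) (b , y) = δ (isOne a) (isOne b) + dist n x y

dist-refl : ∀ n x → dist n x x ≡ 0
dist-refl zero    x                = refl
dist-refl (suc n) (zero     , x)   = dist-refl n x
dist-refl (suc n) (suc zero , x)   = dist-refl n x

dist-flip-agree : ∀ n i {x y} → i < n → bit n x i ≡ bit n y i →
  dist n x (flip n i y) ≡ suc (dist n x y)
dist-flip-agree (suc n) zero    {a , x} {b , y} _ eq
  rewrite isOne-opposite b | δ-not-agree (isOne a) (isOne b) eq = refl
dist-flip-agree (suc n) (suc i) {a , x} {b , y} (s≤s i<n) eq
  rewrite dist-flip-agree n i {x} {y} i<n eq = +-suc _ _

dist-flip-differ : ∀ n i {x y} → i < n → bit n x i ≢ bit n y i →
  suc (dist n x (flip n i y)) ≡ dist n x y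
dist-flip-differ (suc n) zero    {a , x} {b , y} _ neq
  rewrite isOne-opposite b = cong (_+ dist n x y) (δ-not-differ (isOne a) (isOne b) neq)
dist-flip-differ (suc n) (suc i) {a , x} {b , y} (s≤s i<n) neq =
  trans (sym (+-suc _ _)) (cong (δ (isOne a) (isOne b) +_) (dist-flip-differ n i {x} {y} i<n neq))

dist≡0⇒≡ : ∀ n {x y} → dist n x y ≡ 0 → x ≡ y
dist≡0⇒≡ n {x} {y} d≡0 = bit-injective n λ i i<n → agree i i<n
  where
  agree : ∀ i → i < n → bit n x i ≡ bit n y i
  agree i i<n with bit n x i Bool.≟ bit n y i
  ... | yes eq = eq
  ... | no neq with trans (dist-flip-differ n i {x} {y} i<n neq) d≡0
  ... | ()

dist>0⇒differ : ∀ n x y {m} → dist n x y ≡ suc m → ∃[ i ] (i < n × bit n x i ≢ bit n y i)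
dist>0⇒differ (suc n) (a , x) (b , y) d≡ with isOne a Bool.≟ isOne b
... | no neq = 0 , z<s , neq
... | yes eq with isOne a | isOne b
dist>0⇒differ (suc n) (a , x) (b , y) d≡ | yes refl | false | .false
  with i , i<n , neq ← dist>0⇒differ n x y d≡ = suc i , s<s i<n , neq
dist>0⇒differ (suc n) (a , x) (b , y) d≡ | yes refl | true | .true
  with i , i<n , neq ← dist>0⇒differ n x y d≡ = suc i , s<s i<n , neq

dist-flip-≤ : ∀ n i x y → i < n → dist n x (flip n i y) ≤ suc (dist n x y)
dist-flip-≤ n i x y i<n with bit n x i Bool.≟ bit n y i
... | yes eq = ≤-reflexive (dist-flip-agree n i i<n eq)
... | no neq = m≤n⇒m≤1+n (≤-trans (n≤1+n _) (≤-reflexive (dist-flip-differ n i i<n neq)))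

2+m≢m : ∀ {m : ℕ} → suc (suc m) ≢ m
2+m≢m ()

-- Flipping bit i of y brings y closer to x exactly when x and y differ at i.
bit-from-dist : ∀ n {x x′ y y′} i k → i < n → k < n →
  bit n y i ≡ bit n y′ k →
  dist n x y ≡ dist n x′ y′ →
  dist n x (flip n i y) ≡ dist n x′ (flip n k y′) →
  bit n x i ≡ bit n x′ k
bit-from-dist n {x} {x′} {y} {y′} i k i<n k<n yᵢ d d-flip
  with bit n x i Bool.≟ bit n y i | bit n x′ k Bool.≟ bit n y′ k
... | yes p | yes q = trans p (trans yᵢ (sym q))
... | no  p | no  q = trans (¬-not p) (trans (cong not yᵢ) (sym (¬-not q)))
-- In the two mixed cases one flip raises the common distance and the other lowers it, yet the
-- results agree; a number would equal itself plus 2.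
... | yes p | no  q = contradiction
  (trans (cong suc (trans (sym (dist-flip-agree n i i<n p)) d-flip))
    (trans (dist-flip-differ n k k<n q) (sym d)))
  2+m≢m
... | no  p | yes q = contradiction
  (trans (cong suc (trans (sym (dist-flip-agree n k k<n q)) (sym d-flip)))
    (trans (dist-flip-differ n i i<n p) d))
  2+m≢m

module _ (n : ℕ) (f : V (Q n) → V (Q n)) (hom : ∀ {x y} → Adj (Q n) x y → Adj (Q n) (f x) (f y)) where

  -- Induction along a shortest path: flipping a bit where `x` and `y` differ brings `y` one step
  -- closer to `x`, and `f` maps that step to a single step.
  nonexpanding : ∀ m x y → dist n x y ≡ m → dist n (f x) (f y) ≤ m
  nonexpanding zero x y d≡0 rewrite dist≡0⇒≡ n {x} {y} d≡0 = ≤-reflexive (dist-refl n (f y))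
  nonexpanding (suc m) x y d≡ with dist>0⇒differ n x y d≡
  ... | i , i<n , neq
    with j , j<n , eq ← Adj⇒flip n (hom (Graph.adj-sym (Q n) (flip-Adj n i y i<n)))
    rewrite eq =
    ≤-trans (dist-flip-≤ n j _ _ j<n)
      (s≤s (nonexpanding m x (flip n i y)
        (suc-injective (trans (dist-flip-differ n i i<n neq) d≡))))

-- Binary digits and the logarithm.

n≤2^⌈log₂n⌉ : ∀ n → n ≤ 2 ^ ⌈log₂ n ⌉
n≤2^⌈log₂n⌉ n = go n (<-wellFounded n)
  where
  -- `⌈log2⌉` recurses on an accessibility proof, so the induction carries the same proof along and
  -- the two unfold together.
  go : ∀ n (rec : Acc _<_ n) → n ≤ 2 ^ ⌈log2⌉ n rec
  go 0             _        = z≤n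
  go 1             _        = s≤s z≤n
  go (suc (suc n)) (acc rs) with ih ← go (suc ⌈ n /2⌉) (rs (⌈n/2⌉<n n)) = begin
    suc (suc n)                     ≡⟨ cong (2 +_) (⌊n/2⌋+⌈n/2⌉≡n n) ⟨
    suc (suc (⌊ n /2⌋ + ⌈ n /2⌉))   ≡⟨ cong suc (+-suc _ _) ⟨
    suc ⌊ n /2⌋ + suc ⌈ n /2⌉       ≤⟨ +-mono-≤ (≤-trans (s≤s (⌊n/2⌋≤⌈n/2⌉ n)) ih)
                                        (≤-trans ih (≤-reflexive (sym (+-identityʳ _)))) ⟩
    2 ^ suc (⌈log2⌉ (suc ⌈ n /2⌉) _) ∎
    where open ≤-Reasoning

odd : ℕ → Bool
odd 0             = false
odd 1             = true
odd (suc (suc i)) = odd i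

digit : ℕ → ℕ → Bool
digit zero    i = odd i
digit (suc j) i = digit j ⌊ i /2⌋

odd-half-injective : ∀ i k → odd i ≡ odd k → ⌊ i /2⌋ ≡ ⌊ k /2⌋ → i ≡ k
odd-half-injective 0             0             _ _ = refl
odd-half-injective 1             1             _ _ = refl
odd-half-injective 0             1             () _
odd-half-injective 1             0             () _
odd-half-injective 0             (suc (suc _)) _ ()
odd-half-injective 1             (suc (suc _)) _ ()
odd-half-injective (suc (suc _)) 0             _ ()
odd-half-injective (suc (suc _)) 1             _ ()
odd-half-injective (suc (suc i)) (suc (suc k)) p h =
  cong (2 +_) (odd-half-injective i k p (suc-injective h))

⌊n/2⌋<m : ∀ {n m} → n < 2 * m → ⌊ n /2⌋ < m
⌊n/2⌋<m {n} {m} n<2m = ≰⇒> λ m≤h → <⇒≱ n<2m (begin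
  2 * m                 ≤⟨ +-mono-≤ m≤h (≤-trans (≤-reflexive (+-identityʳ m)) (≤-trans m≤h (⌊n/2⌋≤⌈n/2⌉ n))) ⟩
  ⌊ n /2⌋ + ⌈ n /2⌉     ≡⟨ ⌊n/2⌋+⌈n/2⌉≡n n ⟩
  n                     ∎)
  where open ≤-Reasoning

digits-injective : ∀ L {i k} → i < 2 ^ L → k < 2 ^ L →
  (∀ j → j < L → digit j i ≡ digit j k) → i ≡ k
digits-injective zero    {zero} {zero} _ _ _ = refl
digits-injective zero    {suc _} (s≤s ()) _ _
digits-injective zero    {zero} {suc _} _ (s≤s ()) _
digits-injective (suc L) {i} {k} i< k< eq = odd-half-injective i k (eq 0 z<s)
  (digits-injective L (⌊n/2⌋<m i<) (⌊n/2⌋<m k<) (λ j j<L → eq (suc j) (s<s j<L)))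

-- Finite search for the minimum.

-- Only up to _≈_, since without function extensionality functions can be enumerated only
-- up to pointwise equality.
record Finite {A : Set} (_≈_ : A → A → Set) : Set where
  field
    size          : ℕ
    encode        : A → Fin size
    decode        : Fin size → A
    encode-decode : ∀ a → decode (encode a) ≈ a

  ∃? : {P : A → Set} → (∀ {a b} → b ≈ a → P a → P b) → U.Decidable P → Dec (∃ P)
  ∃? resp P? = map′ (λ (i , p) → decode i , p) (λ (a , p) → encode a , resp (encode-decode a) p)
                    (Fin.any? (P? ∘ decode))

finite-Fin : ∀ k → Finite (_≡_ {A = Fin k})
finite-Fin k = record { size = k ; encode = id ; decode = id ; encode-decode = λ _ → refl }

module _ (G : Graph) where
  open Graph G hiding (V; Adj)

  finite-V : Finite (_≡_ {A = V G})
  finite-V = record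
    { size          = length vertices
    ; encode        = index ∘ complete
    ; decode        = lookup vertices
    ; encode-decode = λ v → sym (lookup-index (complete v))
    }

  ∀v? : {P : V G → Set} → U.Decidable P → Dec (∀ v → P v)
  ∀v? P? = map′ (λ ps v → All.lookup ps (complete v)) (λ p → All.tabulate (λ {v} _ → p v))
                (All.all? P? vertices)

  module _ {B : Set} {_≈_ : B → B → Set} (B-finite : Finite _≈_)
           (≈-trans : ∀ {a b c} → a ≈ b → b ≈ c → a ≈ c) (≈-reflexive : ∀ {a b} → a ≡ b → a ≈ b) where
    private module B = Finite B-finite

    -- A function is coded by the tuple of the codes of its values along `vertices`, read as a
    -- numeral in base `B.size`. Decoding at `v` consults the position that `complete` assigns to
    -- `v`.
    finite-V→ : Finite {V G → B} (λ f g → ∀ v → f v ≈ g v)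
    finite-V→ = record
      { size          = B.size ^ length vertices
      ; encode        = λ f → funToFin (B.encode ∘ f ∘ lookup vertices)
      ; decode        = λ i v → B.decode (finToFun i (index (complete v)))
      ; encode-decode = λ f v → ≈-trans
          (≈-reflexive (trans
            (cong B.decode (Fin.finToFun-funToFin (B.encode ∘ f ∘ lookup vertices) (index (complete v))))
            (cong (B.decode ∘ B.encode ∘ f) (sym (lookup-index (complete v))))))
          (B.encode-decode (f v))
      }

  finite-V→V : Finite {V G → V G} _≗_
  finite-V→V = finite-V→ finite-V trans id

  finite-V→V→Fin : ∀ k → Finite {V G → V G → Fin k} (λ f g → ∀ u v → f u v ≡ g u v)
  finite-V→V→Fin k = finite-V→ (finite-V→ (finite-Fin k) trans id) (λ p q v → trans (p v) (q v)) λ { refl _ → refl }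

  -- A nontrivial color-preserving automorphism unpacked into bare functions, with `h` inverse to
  -- `g`. Each clause is a finite check over vertices and respects pointwise equality, so such a
  -- pair can be searched for.
  Breaks : ∀ {k} → (V G → V G → Fin k) → (V G → V G) → (V G → V G) → Set
  Breaks col g h =
    (∀ v → h (g v) ≡ v) × (∀ v → g (h v) ≡ v) ×
    (∀ u v → Adj G u v → Adj G (g u) (g v)) × (∀ u v → Adj G (g u) (g v) → Adj G u v) ×
    (∀ u v → Adj G u v → col (g u) (g v) ≡ col u v) × ¬ (∀ v → g v ≡ v)

  breaks? : ∀ {k} (col : V G → V G → Fin k) g h → Dec (Breaks col g h)
  breaks? col g h =
    ∀v? (λ v → h (g v) ≟ᵛ v) ×-dec ∀v? (λ v → g (h v) ≟ᵛ v) ×-dec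
    ∀v? (λ u → ∀v? λ v → adj? u v →-dec adj? (g u) (g v)) ×-dec
    ∀v? (λ u → ∀v? λ v → adj? (g u) (g v) →-dec adj? u v) ×-dec
    ∀v? (λ u → ∀v? λ v → adj? u v →-dec (col (g u) (g v) Fin.≟ col u v)) ×-dec
    ¬? (∀v? λ v → g v ≟ᵛ v)

  breaks-resp : ∀ {k} {col : V G → V G → Fin k} {g g′ h h′} → g′ ≗ g → h′ ≗ h →
    Breaks col g h → Breaks col g′ h′
  breaks-resp {col = col} {g} {g′} {h} {h′} p q (hg , gh , adj , adj⁻ , pres , moves) =
    (λ v → trans (q (g′ v)) (trans (cong h (p v)) (hg v))) ,
    (λ v → trans (p (h′ v)) (trans (cong g (q v)) (gh v))) ,
    (λ u v → subst₂ (Adj G) (sym (p u)) (sym (p v)) ∘ adj u v) ,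
    (λ u v → adj⁻ u v ∘ subst₂ (Adj G) (p u) (p v)) ,
    (λ u v e → trans (cong₂ col (p u) (p v)) (pres u v e)) ,
    (λ id′ → moves (λ v → trans (sym (p v)) (id′ v)))

  distinguishing? : ∀ {k} (c : EdgeColoring G k) → Dec (Distinguishing c)
  distinguishing? c = map′ sound complete′
    (¬? (F.∃? (λ p (h , b) → h , breaks-resp p (λ _ → refl) b)
      (λ g → F.∃? (λ q → breaks-resp (λ _ → refl) q) (breaks? (color c) g))))
    where
    module F = Finite finite-V→V

    sound : ¬ (∃[ g ] ∃[ h ] Breaks (color c) g h) → Distinguishing c
    -- A failed search only refutes that some vertex moves; decidability of being the identity
    -- removes the double negation.
    sound none f pres = decidable-stable (∀v? λ v → to v ≟ᵛ v) λ moves → none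
      (to , from , (λ v → strictlyInverseʳ v) , (λ v → strictlyInverseˡ v) ,
       (λ u v → Equivalence.to (preserves-adj u v)) , (λ u v → Equivalence.from (preserves-adj u v)) ,
       (λ u v → pres) , moves)
      where
      open Automorphism f
      open Inverse bijection using (strictlyInverseʳ; strictlyInverseˡ)

    complete′ : Distinguishing c → ¬ (∃[ g ] ∃[ h ] Breaks (color c) g h)
    complete′ dist (g , h , hg , gh , adj , adj⁻ , pres , moves) = moves (dist
      (record { bijection = mk↔ₛ′ g h gh hg ; preserves-adj = λ u v → mk⇔ (adj u v) (adj⁻ u v) })
      (λ {u} {v} → pres u v))

  Attains : ℕ → Set
  Attains m = Σ[ c ∈ EdgeColoring G 2 ] (Distinguishing c × smallerClassSize c ≡ m)

  module _ {c c′ : EdgeColoring G 2} (eq : ∀ u v → color c′ u v ≡ color c u v) where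

    distinguishing-resp : Distinguishing c → Distinguishing c′
    distinguishing-resp dist f pres = dist f λ {u} {v} e →
      trans (sym (eq _ _)) (trans (pres e) (eq u v))

    classSize-resp : ∀ i → classSize c′ i ≡ classSize c i
    classSize-resp i = cong length (filter-≐ _ _
      ((λ {(u , v)} → trans (sym (eq u v))) , λ {(u , v)} → trans (eq u v)) (edges G))

    smallerClassSize-resp : smallerClassSize c′ ≡ smallerClassSize c
    smallerClassSize-resp = cong₂ _⊓_ (classSize-resp zero) (classSize-resp (suc zero))

  symmetric-coloring : ∀ {k} (col : V G → V G → Fin k) →
    (∀ u v → Adj G u v → col u v ≡ col v u) → EdgeColoring G k
  symmetric-coloring col s = record { color = col ; color-sym = λ {u} {v} → s u v }

  attains? : ∀ m → Dec (Attains m)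
  attains? m = map′
    (λ (col , s , p) → symmetric-coloring col s , p)
    (λ (c , p) → color c , (λ u v → EdgeColoring.color-sym c) , p)
    (Finite.∃? (finite-V→V→Fin 2) attains-by-resp attains-by?)
    where
    Attains-by : (V G → V G → Fin 2) → Set
    Attains-by col = Σ[ s ∈ (∀ u v → Adj G u v → col u v ≡ col v u) ]
      Distinguishing (symmetric-coloring col s) × smallerClassSize (symmetric-coloring col s) ≡ m

    attains-by-resp : ∀ {col col′} → (∀ u v → col′ u v ≡ col u v) → Attains-by col → Attains-by col′
    attains-by-resp {col} {col′} eq (s , dist , size) =
      s′ , distinguishing-resp {c} {c′} eq dist , trans (smallerClassSize-resp {c} {c′} eq) size
      where
      s′ : ∀ u v → Adj G u v → col′ u v ≡ col′ v u
      s′ u v e = trans (eq u v) (trans (s u v e) (sym (eq v u)))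
      c c′ : EdgeColoring G 2
      c  = symmetric-coloring col s
      c′ = symmetric-coloring col′ s′

    attains-by? : ∀ col → Dec (Attains-by col)
    attains-by? col with ∀v? (λ u → ∀v? λ v → adj? u v →-dec (col u v Fin.≟ col v u))
    ... | no ¬s = no (¬s ∘ proj₁)
    -- `Distinguishing` and `smallerClassSize` read only the `color` field, so evidence given for
    -- another symmetry proof serves for `s` as well.
    ... | yes s = map′ (s ,_) (λ (_ , p) → p)
      (distinguishing? (symmetric-coloring col s) ×-dec (smallerClassSize (symmetric-coloring col s) ≟ m))

-- Counting up from 0, the first success is the least one, and the known witness `m` bounds the
-- search. An upper bound by one coloring thus becomes a bound on an existing minimum.
least : {P : ℕ → Set} → U.Decidable P → ∀ {m} → P m → ∃[ k ] (k ≤ m × IsLeast P k)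
least P? {zero}  p = 0 , z≤n , p , λ _ _ → z≤n
least {P} P? {suc m} p with P? 0
... | yes p₀ = 0 , z≤n , p₀ , λ _ _ → z≤n
... | no ¬p₀ with k , k≤m , pk , min ← least {P ∘ suc} (P? ∘ suc) p =
  suc k , s≤s k≤m , pk , λ { zero p₀ → contradiction p₀ ¬p₀ ; (suc j) pj → s≤s (min j pj) }

-- Bounding a color class by a list of edges.

module _ {A : Set} where

  -- Distinctness as unordered pairs: `edges` lists each edge in one orientation that is not known
  -- in advance.
  Apart : A × A → A × A → Set
  Apart p q = p ≢ q × p ≢ swap q

  pairs-∈ : ∀ (xs : List A) {x y} → (x , y) ∈ pairs xs → x ∈ xs
  pairs-∈ (z ∷ xs) p with ∈-++⁻ (map (z ,_) xs) p
  ... | inj₁ q with _ , _ , refl ← ∈-map⁻ (z ,_) q = here refl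
  ... | inj₂ q = there (pairs-∈ xs q)

  pairs-∈₂ : ∀ (xs : List A) {x y} → (x , y) ∈ pairs xs → y ∈ xs
  pairs-∈₂ (z ∷ xs) p with ∈-++⁻ (map (z ,_) xs) p
  ... | inj₁ q with _ , y∈ , refl ← ∈-map⁻ (z ,_) q = there y∈
  ... | inj₂ q = there (pairs-∈₂ xs q)

  -- A later pair avoids the head `x` altogether, so it can equal a pair starting with `x` in
  -- neither orientation.
  pairs-apart : ∀ {xs : List A} → Unique xs → AllPairs Apart (pairs xs)
  pairs-apart []             = []
  pairs-apart {x ∷ xs} (x∉ ∷ u) = AllPairs.++⁺
    (AllPairs.map⁺ (head u x∉))
    (pairs-apart u)
    (All.map⁺ (All.tabulate λ _ → All.tabulate λ {(a , b)} ab →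
      (λ { refl → All.lookup x∉ (pairs-∈ xs ab) refl }) ,
      (λ { refl → All.lookup x∉ (pairs-∈₂ xs ab) refl })))
    where
    head : ∀ {ys} → Unique ys → All (x ≢_) ys → AllPairs (λ y z → Apart (x , y) (x , z)) ys
    head []        []            = []
    head (y∉ ∷ u′) (x≢y ∷ x∉′) =
      All.zipWith (λ (y≢z , x≢z) → (λ { refl → y≢z refl }) , (λ { refl → x≢y refl })) (y∉ , x∉′) ∷ head u′ x∉′

  AllPairs-lookup : ∀ {R : A → A → Set} {xs} → AllPairs R xs → ∀ {i j} → i Fin.< j →
    R (lookup xs i) (lookup xs j)
  AllPairs-lookup (rs ∷ _)  {zero}  {suc j} _         = All.lookup rs (∈-lookup j)
  AllPairs-lookup (_  ∷ ps) {suc i} {suc j} (s≤s i<j) = AllPairs-lookup ps i<j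

-- Sending a pair to the position in `es` of itself or of its swap is injective, since two pairs at
-- one position are equal or swapped.
apart-length : ∀ {A : Set} {es ps : List (A × A)} → AllPairs Apart ps →
  (∀ {p} → p ∈ ps → p ∈ es ⊎ swap p ∈ es) → length ps ≤ length es
apart-length {A} {es} {ps} apart sub = Fin.injective⇒≤ position-injective
  where
  edge-of : ∀ {p} → p ∈ es ⊎ swap p ∈ es → Fin (length es)
  edge-of (inj₁ e) = index e
  edge-of (inj₂ e) = index e

  edge-of-apart : ∀ {p q} (e : p ∈ es ⊎ swap p ∈ es) (e′ : q ∈ es ⊎ swap q ∈ es) →
    edge-of e ≡ edge-of e′ → ¬ Apart p q
  edge-of-apart (inj₁ e) (inj₁ e′) eq (p≢q , _) =
    p≢q (trans (lookup-index e) (trans (cong (lookup es) eq) (sym (lookup-index e′))))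
  edge-of-apart (inj₁ e) (inj₂ e′) eq (_ , p≢q) =
    p≢q (trans (lookup-index e) (trans (cong (lookup es) eq) (sym (lookup-index e′))))
  edge-of-apart (inj₂ e) (inj₁ e′) eq (_ , p≢q) =
    p≢q (cong swap (trans (lookup-index e) (trans (cong (lookup es) eq) (sym (lookup-index e′)))))
  edge-of-apart (inj₂ e) (inj₂ e′) eq (p≢q , _) =
    p≢q (cong swap (trans (lookup-index e) (trans (cong (lookup es) eq) (sym (lookup-index e′)))))

  position : Fin (length ps) → Fin (length es)
  position i = edge-of (sub (∈-lookup i))

  position-injective : ∀ {i j} → position i ≡ position j → i ≡ j
  position-injective {i} {j} eq with Fin.<-cmp i j
  ... | tri< i<j _ _ = contradiction (AllPairs-lookup apart i<j)
                         (edge-of-apart (sub (∈-lookup i)) (sub (∈-lookup j)) eq)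
  ... | tri≈ _ i≡j _ = i≡j
  ... | tri> _ _ j<i = contradiction (AllPairs-lookup apart j<i)
                         (edge-of-apart (sub (∈-lookup j)) (sub (∈-lookup i)) (sym eq))

classSize-≤ : ∀ {G k} (c : EdgeColoring G k) i (es : List (V G × V G)) →
  (∀ {u v} → color c u v ≡ i → (u , v) ∈ es ⊎ (v , u) ∈ es) →
  classSize c i ≤ length es
classSize-≤ {G} c i es cover = apart-length
  (AllPairs.filter⁺ color≟i (AllPairs.filter⁺ (λ (u , v) → Graph.adj? G u v) (pairs-apart (Graph.unique G))))
  (λ p∈ → cover (proj₂ (∈-filter⁻ color≟i {xs = edges G} p∈)))
  where
  color≟i : U.Decidable (λ ((u , v) : V G × V G) → color c u v ≡ i)
  color≟i (u , v) = color c u v Fin.≟ i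

-- The red pattern: chain, spokes and rows.

module Pattern (n L : ℕ) (3≤L : 3 ≤ L) (2+L≤n : 2 + L ≤ n) (n≤2^L : n ≤ 2 ^ L) where

  Vₙ : Set
  Vₙ = V (Q n)

  1+L<n : 1 + L < n
  1+L<n = 2+L≤n

  <2+L⇒<n : ∀ {i} → i < 2 + L → i < n
  <2+L⇒<n i< = <-≤-trans i< 2+L≤n

  ≤2⇒<2+L : ∀ {i} → i ≤ 2 → i < 2 + L
  ≤2⇒<2+L i≤2 = s≤s (≤-trans i≤2 (≤-trans (s≤s (s≤s z≤n)) (≤-trans 3≤L (n≤1+n L))))

  chain : ℕ → Vₙ
  chain w = vertex n λ i → does (i <? w)

  -- Bit 0 is 0 to keep rows apart from `chain w` with `w ≥ 1`. Bits 1, ..., `L` are a tag naming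
  -- the row, written with a single 0 because a tag with a single 1 could make a row coincide with
  -- the end of a spoke. Bit `1 + L` is 0 since the red edge of the row leaves upwards in that
  -- direction. The remaining bits carry the digits.
  rowBit : ℕ → ℕ → Bool
  rowBit j zero    = false
  rowBit j (suc i) with <-cmp i L
  ... | tri< _ _ _ = not (does (i ≟ j))
  ... | tri≈ _ _ _ = false
  ... | tri> _ _ _ = digit j (suc i)

  row : ℕ → Vₙ
  row j = vertex n (rowBit j)

  bit-chain-< : ∀ {w i} → i < n → i < w → bit n (chain w) i ≡ true
  bit-chain-< {w} {i} i<n i<w = trans (bit-vertex n _ i<n) (dec-true (i <? w) i<w)

  bit-chain-≥ : ∀ {w i} → i < n → i ≮ w → bit n (chain w) i ≡ false
  bit-chain-≥ {w} {i} i<n i≮w = trans (bit-vertex n _ i<n) (dec-false (i <? w) i≮w)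

  bit-origin : ∀ {i} → i < n → bit n (chain 0) i ≡ false
  bit-origin i<n = bit-chain-≥ {0} i<n λ ()

  bit-row-0 : ∀ j → bit n (row j) 0 ≡ false
  bit-row-0 j = bit-vertex n (rowBit j) (<2+L⇒<n z<s)

  bit-row-tag : ∀ j {m} → m < L → bit n (row j) (suc m) ≡ not (does (m ≟ j))
  bit-row-tag j {m} m<L = trans (bit-vertex n (rowBit j) (<2+L⇒<n (s≤s (m≤n⇒m≤1+n m<L)))) tag
    where
    tag : rowBit j (suc m) ≡ not (does (m ≟ j))
    tag with <-cmp m L
    ... | tri< _ _ _   = refl
    ... | tri≈ m≮L _ _ = contradiction m<L m≮L
    ... | tri> m≮L _ _ = contradiction m<L m≮L

  bit-row-1+L : ∀ j → bit n (row j) (suc L) ≡ false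
  bit-row-1+L j = trans (bit-vertex n (rowBit j) 1+L<n) last
    where
    last : rowBit j (suc L) ≡ false
    last with <-cmp L L
    ... | tri< _ L≢L _ = contradiction refl L≢L
    ... | tri≈ _ _ _   = refl
    ... | tri> _ L≢L _ = contradiction refl L≢L

  bit-row-digit : ∀ j {i} → 2 + L ≤ i → i < n → bit n (row j) i ≡ digit j i
  bit-row-digit j {suc i} (s≤s L<i) i<n = trans (bit-vertex n (rowBit j) i<n) rest
    where
    rest : rowBit j (suc i) ≡ digit j (suc i)
    rest with <-cmp i L
    ... | tri< _ _ L≮i = contradiction L<i L≮i
    ... | tri≈ _ _ L≮i = contradiction L<i L≮i
    ... | tri> _ _ _   = refl

  bits-differ : ∀ {x y : Vₙ} {i a} → bit n x i ≡ a → bit n y i ≡ not a → x ≢ y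
  bits-differ {i = i} p q refl = not-¬ p q

  flip-chain : ∀ {w} → w < n → flip n w (chain w) ≡ chain (suc w)
  flip-chain {w} w<n = bit-injective n λ i i<n → go i i<n (<-cmp i w)
    where
    go : ∀ i → i < n → _ → bit n (flip n w (chain w)) i ≡ bit n (chain (suc w)) i
    go i i<n (tri< i<w i≢w _) = trans (bit-flip-other n w _ i (i≢w ∘ sym))
      (trans (bit-chain-< i<n i<w) (sym (bit-chain-< i<n (m<n⇒m<1+n i<w))))
    go i i<n (tri≈ i≮i refl _) = trans (bit-flip n w _ i<n)
      (trans (cong not (bit-chain-≥ i<n i≮i)) (sym (bit-chain-< i<n ≤-refl)))
    go i i<n (tri> _ i≢w w<i) = trans (bit-flip-other n w _ i (i≢w ∘ sym))
      (trans (bit-chain-≥ i<n (<⇒≯ w<i)) (sym (bit-chain-≥ i<n (<⇒≱ (s≤s w<i)))))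

  chain-injective : ∀ {w w′} → w ≤ n → w′ ≤ n → chain w ≡ chain w′ → w ≡ w′
  chain-injective {w} {w′} w≤n w′≤n eq with <-cmp w w′
  ... | tri< w<w′ _ _ = contradiction (sym eq)
    (bits-differ (bit-chain-< (<-≤-trans w<w′ w′≤n) w<w′) (bit-chain-≥ (<-≤-trans w<w′ w′≤n) (<-irrefl refl)))
  ... | tri≈ _ w≡w′ _ = w≡w′
  ... | tri> _ _ w′<w = contradiction eq
    (bits-differ (bit-chain-< (<-≤-trans w′<w w≤n) w′<w) (bit-chain-≥ (<-≤-trans w′<w w≤n) (<-irrefl refl)))

  chain-injective₀ : ∀ {w} → chain w ≡ chain 0 → w ≡ 0
  chain-injective₀ {zero}  _  = refl
  chain-injective₀ {suc w} eq = contradiction eq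
    (bits-differ (bit-chain-< (<2+L⇒<n z<s) z<s) (bit-origin (<2+L⇒<n z<s)))

  -- Comparing bit `j + 1` is enough: it is 0 in row `j` and 1 in every other row.
  row-tags-injective : ∀ {j j′} → j < L →
    (∀ m → m < L → bit n (row j) (suc m) ≡ bit n (row j′) (suc m)) → j ≡ j′
  row-tags-injective {j} {j′} j<L eq with j ≟ j′
  ... | yes j≡j′ = j≡j′
  ... | no  j≢j′ = contradiction
    (trans (sym (trans (bit-row-tag j j<L) (cong not (dec-true (j ≟ j) refl))))
      (trans (eq j j<L) (trans (bit-row-tag j′ j<L) (cong not (dec-false (j ≟ j′) j≢j′)))))
    λ ()

  -- Among the bits 1, …, L of row j only bit j + 1 is 0.
  row-≢-sparse : ∀ {j} {x : Vₙ} p q → p < L → q < L → p ≢ q →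
    bit n x (suc p) ≡ false → bit n x (suc q) ≡ false → row j ≢ x
  row-≢-sparse {j} p q p<L q<L p≢q xp xq with p ≟ j
  ... | no  p≢j  = bits-differ (trans (bit-row-tag j p<L) (cong not (dec-false (p ≟ j) p≢j))) xp
  ... | yes refl = bits-differ (trans (bit-row-tag j q<L) (cong not (dec-false (q ≟ p) (p≢q ∘ sym)))) xq

  row≢origin : ∀ {j} → row j ≢ chain 0
  row≢origin = row-≢-sparse 0 1 (≤-trans (s≤s z≤n) 3≤L) (≤-trans (s≤s (s≤s z≤n)) 3≤L) (λ ())
    (bit-origin (<2+L⇒<n (≤2⇒<2+L (s≤s z≤n)))) (bit-origin (<2+L⇒<n (≤2⇒<2+L ≤-refl)))

  -- Red x i: the edge from x in direction i is red, and x has bit i equal to 0.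
  data Red : Vₙ → ℕ → Set where
    chainᵉ : ∀ {w} → w < 2 + L → Red (chain w) w
    spokeᵉ : ∀ {i} → 1 ≤ i → i ≤ 2 → Red (chain 0) i
    rowᵉ   : ∀ {j} → j < L → Red (row j) (suc L)

  red-<n : ∀ {x i} → Red x i → i < n
  red-<n (chainᵉ w<)    = <2+L⇒<n w<
  red-<n (spokeᵉ _ i≤2) = <2+L⇒<n (≤2⇒<2+L i≤2)
  red-<n (rowᵉ _)       = 1+L<n

  red-bit : ∀ {x i} → Red x i → bit n x i ≡ false
  red-bit (chainᵉ w<)        = bit-chain-≥ (<2+L⇒<n w<) (<-irrefl refl)
  red-bit e@(spokeᵉ _ _)     = bit-origin (red-<n e)
  red-bit (rowᵉ {j} _)       = bit-row-1+L j

  -- Bit 0 is 1 on `chain w` with `w ≥ 1` and 0 on every row, so the kinds do not meet away from the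
  -- origin. Within a kind, a chain vertex determines its length, and all row edges share one
  -- direction.
  red-source : ∀ {x y i k} → Red x i → Red y k → x ≡ y → x ≢ chain 0 → i ≡ k
  red-source (chainᵉ w<) (chainᵉ w′<) eq _ = chain-injective (<⇒≤ (<2+L⇒<n w<)) (<⇒≤ (<2+L⇒<n w′<)) eq
  red-source (rowᵉ _)    (rowᵉ _)     _  _ = refl
  red-source (spokeᵉ _ _) _ _ x≢0 = contradiction refl x≢0
  red-source _ (spokeᵉ _ _) eq x≢0 = contradiction eq x≢0
  red-source (chainᵉ {zero} _)  (rowᵉ _) _ x≢0 = contradiction refl x≢0
  red-source (chainᵉ {suc w} _) (rowᵉ {j} _) eq _ = contradiction eq
    (bits-differ (bit-chain-< (<2+L⇒<n z<s) z<s) (bit-row-0 j))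
  red-source (rowᵉ _) (chainᵉ {zero} _)  eq x≢0 = contradiction eq x≢0
  red-source (rowᵉ {j} _) (chainᵉ {suc w} _) eq _ = contradiction (sym eq)
    (bits-differ (bit-chain-< (<2+L⇒<n z<s) z<s) (bit-row-0 j))

  chain-target-0 : ∀ w → w < 2 + L → bit n (flip n w (chain w)) 0 ≡ true
  chain-target-0 w w< = trans (cong (λ x → bit n x 0) (flip-chain (<2+L⇒<n w<))) (bit-chain-< (<2+L⇒<n z<s) z<s)

  spoke-target-0 : ∀ {i} → 1 ≤ i → bit n (flip n i (chain 0)) 0 ≡ false
  spoke-target-0 {suc i} _ = trans (bit-flip-other n (suc i) _ 0 (λ ())) (bit-origin (<2+L⇒<n z<s))

  row-target-0 : ∀ j → bit n (flip n (suc L) (row j)) 0 ≡ false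
  row-target-0 j = trans (bit-flip-other n (suc L) _ 0 (λ ())) (bit-row-0 j)

  row-target-1+L : ∀ j → bit n (flip n (suc L) (row j)) (suc L) ≡ true
  row-target-1+L j = trans (bit-flip n (suc L) _ 1+L<n) (cong not (bit-row-1+L j))

  spoke-target-1+L : ∀ {i} → i ≤ 2 → bit n (flip n i (chain 0)) (suc L) ≡ false
  spoke-target-1+L {i} i≤2 = trans (bit-flip-other n i _ (suc L) (<⇒≢ (s≤s (≤-trans i≤2 (<⇒≤ 3≤L)))))
    (bit-origin 1+L<n)

  -- Bits 0 and `1 + L` of the upper end reveal the kind of edge: bit 0 is 1 only for the chain, and
  -- among the others bit `1 + L` is 1 for rows and 0 for spokes.
  red-target : ∀ {x y i k} → Red x i → Red y k → flip n i x ≡ flip n k y → x ≡ y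
  red-target (chainᵉ {w} w<) (chainᵉ {w′} w′<) eq = cong chain (suc-injective
    (chain-injective (<2+L⇒<n w<) (<2+L⇒<n w′<)
      (trans (sym (flip-chain (<2+L⇒<n w<))) (trans eq (flip-chain (<2+L⇒<n w′<))))))
  red-target (spokeᵉ _ _) (spokeᵉ _ _) _ = refl
  red-target (rowᵉ _) (rowᵉ _) eq = flip-injective n (suc L) eq
  red-target (chainᵉ w<) (spokeᵉ 1≤i _) eq = contradiction eq (bits-differ (chain-target-0 _ w<) (spoke-target-0 1≤i))
  red-target (spokeᵉ 1≤i _) (chainᵉ w<) eq = contradiction (sym eq) (bits-differ (chain-target-0 _ w<) (spoke-target-0 1≤i))
  red-target (chainᵉ w<) (rowᵉ _) eq = contradiction eq (bits-differ (chain-target-0 _ w<) (row-target-0 _))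
  red-target (rowᵉ _) (chainᵉ w<) eq = contradiction (sym eq) (bits-differ (chain-target-0 _ w<) (row-target-0 _))
  red-target (rowᵉ _) (spokeᵉ _ i≤2) eq = contradiction eq (bits-differ (row-target-1+L _) (spoke-target-1+L i≤2))
  red-target (spokeᵉ _ i≤2) (rowᵉ _) eq = contradiction (sym eq) (bits-differ (row-target-1+L _) (spoke-target-1+L i≤2))

  Up : Vₙ → Vₙ → Set
  Up x y = ∃[ i ] (Red x i × y ≡ flip n i x)

  RedEdge : Vₙ → Vₙ → Set
  RedEdge x y = Up x y ⊎ Up y x

  up-unique : ∀ {x y y′} → x ≢ chain 0 → Up x y → Up x y′ → y ≡ y′
  up-unique {x} x≢0 (i , e , p) (k , e′ , q) =
    trans p (trans (cong (λ l → flip n l x) (red-source e e′ refl x≢0)) (sym q))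

  down-unique : ∀ {x y y′} → Up y x → Up y′ x → y ≡ y′
  down-unique (i , e , p) (k , e′ , q) = red-target e e′ (trans (sym p) q)

  -- Away from the origin there is at most one red edge up and at most one down, while two of any
  -- three edges go the same way.
  degree-3⇒origin : ∀ {x y₁ y₂ y₃} → RedEdge x y₁ → RedEdge x y₂ → RedEdge x y₃ →
    y₁ ≢ y₂ → y₁ ≢ y₃ → y₂ ≢ y₃ → x ≡ chain 0
  degree-3⇒origin {x} e₁ e₂ e₃ ≢₁₂ ≢₁₃ ≢₂₃ with Graph._≟ᵛ_ (Q n) x (chain 0)
  ... | yes x≡0 = x≡0
  ... | no  x≢0 = contradiction (e₁ , e₂ , e₃) λ
    { (inj₁ u₁ , inj₁ u₂ , _) → ≢₁₂ (up-unique x≢0 u₁ u₂)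
    ; (inj₂ d₁ , inj₂ d₂ , _) → ≢₁₂ (down-unique d₁ d₂)
    ; (inj₁ u₁ , inj₂ d₂ , inj₁ u₃) → ≢₁₃ (up-unique x≢0 u₁ u₃)
    ; (inj₁ u₁ , inj₂ d₂ , inj₂ d₃) → ≢₂₃ (down-unique d₂ d₃)
    ; (inj₂ d₁ , inj₁ u₂ , inj₁ u₃) → ≢₂₃ (up-unique x≢0 u₂ u₃)
    ; (inj₂ d₁ , inj₁ u₂ , inj₂ d₃) → ≢₁₃ (down-unique d₁ d₃)
    }

  up-Adj : ∀ {x y} → Up x y → Adj (Q n) x y
  up-Adj {x} (i , e , refl) = flip-Adj n i x (red-<n e)

  redEdge-Adj : ∀ {x y} → RedEdge x y → Adj (Q n) x y
  redEdge-Adj (inj₁ u) = up-Adj u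
  redEdge-Adj (inj₂ d) = Graph.adj-sym (Q n) (up-Adj d)

  chain-up : ∀ {w} → w < 2 + L → Up (chain w) (chain (suc w))
  chain-up {w} w< = w , chainᵉ w< , sym (flip-chain (<2+L⇒<n w<))

  origin-up : ∀ i → i ≤ 2 → Up (chain 0) (flip n i (chain 0))
  origin-up zero    _   = 0 , chainᵉ z<s , refl
  origin-up (suc i) i≤2 = suc i , spokeᵉ (s≤s z≤n) i≤2 , refl

  up-dist : ∀ {x y} → Up x y → dist n (chain 0) y ≡ suc (dist n (chain 0) x)
  up-dist (i , e , refl) = dist-flip-agree n i (red-<n e) (trans (bit-origin (red-<n e)) (sym (red-bit e)))

  flips-differ : ∀ {i k} x → i < n → i ≢ k → flip n i x ≢ flip n k x
  flips-differ {i} {k} x i<n i≢k eq = not-¬ refl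
    (trans (sym (bit-flip-other n k x i (i≢k ∘ sym))) (trans (cong (λ y → bit n y i) (sym eq)) (bit-flip n i x i<n)))

  -- An automorphism preserving the red edges is the identity.

  module Fixing (f g : Vₙ → Vₙ) (gf : ∀ x → g (f x) ≡ x) (fg : ∀ x → f (g x) ≡ x)
    (f-hom : ∀ {x y} → Adj (Q n) x y → Adj (Q n) (f x) (f y))
    (g-hom : ∀ {x y} → Adj (Q n) x y → Adj (Q n) (g x) (g y))
    (f-red : ∀ {x y} → RedEdge x y → RedEdge (f x) (f y)) where

    f-injective : ∀ {x y} → f x ≡ f y → x ≡ y
    f-injective {x} {y} eq = trans (sym (gf x)) (trans (cong g eq) (gf y))

    -- Both `f` and its inverse are nonexpanding.
    isometry : ∀ x y → dist n (f x) (f y) ≡ dist n x y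
    isometry x y = ≤-antisym (nonexpanding n f f-hom _ x y refl)
      (subst₂ (λ a b → dist n a b ≤ dist n (f x) (f y)) (gf x) (gf y)
        (nonexpanding n g g-hom _ (f x) (f y) refl))

    isometry-to-fixed : ∀ x {y} → f y ≡ y → dist n (f x) y ≡ dist n x y
    isometry-to-fixed x {y} fy = trans (cong (dist n (f x)) (sym fy)) (isometry x y)

    origin-fixed : f (chain 0) ≡ chain 0
    origin-fixed = degree-3⇒origin (spoke 0 z≤n) (spoke 1 (s≤s z≤n)) (spoke 2 ≤-refl)
      (differ z<s (λ ())) (differ z<s (λ ())) (differ (≤2⇒<2+L (s≤s z≤n)) (λ ()))
      where
      spoke : ∀ i → i ≤ 2 → RedEdge (f (chain 0)) (f (flip n i (chain 0)))
      spoke i i≤2 = f-red (inj₁ (origin-up i i≤2))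
      differ : ∀ {i k} → i < 2 + L → i ≢ k → f (flip n i (chain 0)) ≢ f (flip n k (chain 0))
      differ i< i≢k eq = flips-differ (chain 0) (<2+L⇒<n i<) i≢k (f-injective eq)

    level-preserved : ∀ x → dist n (chain 0) (f x) ≡ dist n (chain 0) x
    level-preserved x = trans (cong (λ o → dist n o (f x)) (sym origin-fixed)) (isometry (chain 0) x)

    -- An upward red edge raises the distance to the origin by one, and `f` preserves that distance;
    -- a reversed image would make a level equal to itself plus 2.
    up-preserved : ∀ {x y} → Up x y → Up (f x) (f y)
    up-preserved {x} {y} u with f-red (inj₁ u)
    ... | inj₁ u′ = u′
    ... | inj₂ d  = contradiction
      (trans (cong suc (trans (sym (up-dist u)) (sym (level-preserved y))))
        (trans (sym (up-dist d)) (level-preserved x)))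
      2+m≢m

    -- The image is the upper end of one of the three red edges at the origin and, like `chain 1`,
    -- has a red edge going further up. The ends of the two spokes have none.
    chain-1-fixed : f (chain 1) ≡ chain 1
    chain-1-fixed
      with i , e , p ← subst (λ o → Up o (f (chain 1))) origin-fixed (up-preserved (chain-up z<s))
         | k , e′ , _ ← up-preserved (chain-up (≤2⇒<2+L (s≤s z≤n)))
      = go e refl p e′
      where
      -- `chain` and `row` are functions rather than constructors, so `Red` is matched at a variable
      -- vertex tied to the origin by an equation.
      go : ∀ {x i k} → Red x i → x ≡ chain 0 → f (chain 1) ≡ flip n i (chain 0) → Red (f (chain 1)) k →
        f (chain 1) ≡ chain 1
      go (rowᵉ _) x≡0 _ _ = contradiction x≡0 row≢origin
      go (chainᵉ {w} w<) x≡0 p _ with refl ← chain-injective₀ {w} x≡0 = trans p (flip-chain (<2+L⇒<n z<s))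
      go {i = i} (spokeᵉ 1≤i i≤2) _ p e′ = contradiction p (spoke-end e′)
        where
        i<n : i < n
        i<n = <2+L⇒<n (≤2⇒<2+L i≤2)
        origin≢ : chain 0 ≢ flip n i (chain 0)
        origin≢ = bits-differ (bit-origin i<n) (trans (bit-flip n i _ i<n) (cong not (bit-origin i<n)))
        off : ∀ {m} → suc m < n → i ≢ suc m → bit n (flip n i (chain 0)) (suc m) ≡ false
        off m< i≢ = trans (bit-flip-other n i _ _ i≢) (bit-origin m<)
        0<L : 0 < L
        0<L = ≤-trans (s≤s z≤n) 3≤L
        1<L : 1 < L
        1<L = ≤-trans (s≤s (s≤s z≤n)) 3≤L
        tag<n : ∀ {m} → m < L → suc m < n
        tag<n m<L = <2+L⇒<n (s≤s (m≤n⇒m≤1+n m<L))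
        row≢ : ∀ i → 1 ≤ i → i ≤ 2 → ∀ j → (∀ {m} → suc m < n → i ≢ suc m → bit n (flip n i (chain 0)) (suc m) ≡ false) →
          row j ≢ flip n i (chain 0)
        -- The end of spoke `i` has a 1 among the bits 1, 2, 3 only at `i`. The other two are tag
        -- bits equal to 0, which no row has; three tag bits exist because `3 ≤ L`.
        row≢ 1 _ _ j off = row-≢-sparse 1 2 1<L 3≤L (λ ()) (off (tag<n 1<L) (λ ())) (off (tag<n 3≤L) (λ ()))
        row≢ 2 _ _ j off = row-≢-sparse 0 2 0<L 3≤L (λ ()) (off (tag<n 0<L) (λ ())) (off (tag<n 3≤L) (λ ()))
        row≢ (suc (suc (suc _))) _ (s≤s (s≤s ())) _ _
        spoke-end : ∀ {x k} → Red x k → x ≢ flip n i (chain 0)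
        spoke-end (chainᵉ {zero} _)  = origin≢
        spoke-end (chainᵉ {suc w} _) = bits-differ (bit-chain-< (<2+L⇒<n z<s) z<s) (spoke-target-0 1≤i)
        spoke-end (spokeᵉ _ _)       = origin≢
        spoke-end (rowᵉ {j} _)       = row≢ i 1≤i i≤2 j off

    -- Past the origin the upward red edge is unique, so fixedness passes from each vertex of the
    -- path to the next.
    chain-fixed : ∀ w → w ≤ 2 + L → f (chain w) ≡ chain w
    chain-fixed 0             _  = origin-fixed
    chain-fixed 1             _  = chain-1-fixed
    chain-fixed (suc (suc w)) w≤ = up-unique (λ eq → contradiction (chain-injective₀ {suc w} eq) λ ())
      (subst (λ x → Up x (f (chain (suc (suc w))))) (chain-fixed (suc w) (<⇒≤ w≤)) (up-preserved (chain-up w≤)))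
      (chain-up w≤)

    -- `chain i` and `chain (suc i)` are fixed and differ exactly in bit `i`, so the distances to
    -- them determine that bit.
    tag-preserved : ∀ x i → i < 2 + L → bit n (f x) i ≡ bit n x i
    tag-preserved x i i< = bit-from-dist n i i (<2+L⇒<n i<) (<2+L⇒<n i<) refl
      (isometry-to-fixed x (chain-fixed i (<⇒≤ i<)))
      (subst (λ y → dist n (f x) y ≡ dist n x y) (sym (flip-chain (<2+L⇒<n i<)))
        (isometry-to-fixed x (chain-fixed (suc i) i<)))

    -- The image also has an upward red edge, so it is a chain vertex or a row. Injectivity excludes
    -- the origin, preservation of bit 0 excludes the rest of the chain, and the preserved tag
    -- selects the row.
    row-fixed : ∀ j → j < L → f (row j) ≡ row j
    row-fixed j j<L with k , e , _ ← up-preserved {row j} (suc L , rowᵉ j<L , refl) = go e refl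
      where
      f-row≢origin : f (row j) ≢ chain 0
      f-row≢origin eq = row≢origin (f-injective (trans eq (sym origin-fixed)))
      go : ∀ {x k} → Red x k → x ≡ f (row j) → f (row j) ≡ row j
      go (chainᵉ {zero} _)  eq = contradiction (sym eq) f-row≢origin
      go (chainᵉ {suc w} _) eq = contradiction eq (bits-differ (bit-chain-< (<2+L⇒<n z<s) z<s)
        (trans (tag-preserved (row j) 0 z<s) (bit-row-0 j)))
      go (spokeᵉ _ _)       eq = contradiction (sym eq) f-row≢origin
      go (rowᵉ {j′} _)      eq = trans (sym eq) (cong row (sym (row-tags-injective j<L λ m m<L →
        trans (sym (tag-preserved (row j) (suc m) (s≤s (m≤n⇒m≤1+n m<L))))
          (cong (λ x → bit n x (suc m)) (sym eq)))))

    -- For `i < k` the vertex `chain (suc i)` has bit `i` but not bit `k`; for `k < i` the vertex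
    -- `chain i` has bit `k` but not bit `i`.
    chain-separates : ∀ {i k} → i < n → k < n → i < 2 + L →
      (∀ y → f y ≡ y → bit n y i ≡ bit n y k) → i ≡ k
    chain-separates {i} {k} i<n k<n i< eq with <-cmp i k
    ... | tri≈ _ i≡k _ = i≡k
    ... | tri< i<k _ _ = contradiction
      (trans (sym (bit-chain-< i<n ≤-refl)) (trans (eq _ (chain-fixed (suc i) i<)) (bit-chain-≥ k<n (<⇒≱ (s≤s i<k)))))
      λ ()
    ... | tri> _ _ k<i = contradiction
      (trans (sym (bit-chain-≥ i<n (<-irrefl refl))) (trans (eq _ (chain-fixed i (<⇒≤ i<))) (bit-chain-< k<n k<i)))
      λ ()

    columns-distinct : ∀ {i k} → i < n → k < n →
      (∀ y → f y ≡ y → bit n y i ≡ bit n y k) → i ≡ k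
    columns-distinct {i} {k} i<n k<n eq with i <? 2 + L | k <? 2 + L
    ... | yes i< | _ = chain-separates i<n k<n i< eq
    ... | no _   | yes k< = sym (chain-separates k<n i<n k< λ y fy → sym (eq y fy))
    -- Both coordinates lie in the digit area, where the fixed rows show all `L` digits of `i` and
    -- of `k`; `n ≤ 2 ^ L` makes these digits decisive.
    ... | no i≮  | no k≮ = digits-injective L (<-≤-trans i<n n≤2^L) (<-≤-trans k<n n≤2^L) λ j j<L →
      trans (sym (bit-row-digit j (≮⇒≥ i≮) i<n))
        (trans (eq (row j) (row-fixed j j<L)) (bit-row-digit j (≮⇒≥ k≮) k<n))

    -- Neighbours of the fixed origin are permuted, say direction `i` goes to `k`. A fixed `y` is
    -- equally far from both neighbours, so its bits `i` and `k` agree, and `columns-distinct`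
    -- applies.
    neighbour-fixed : ∀ i → i < n → f (flip n i (chain 0)) ≡ flip n i (chain 0)
    neighbour-fixed i i<n
      with k , k<n , p ← Adj⇒flip n (subst (λ o → Adj (Q n) o (f (flip n i (chain 0)))) origin-fixed
             (f-hom (flip-Adj n i (chain 0) i<n)))
      = trans p (cong (λ l → flip n l (chain 0)) (sym (columns-distinct i<n k<n λ y fy →
          bit-from-dist n i k i<n k<n (trans (bit-origin i<n) (sym (bit-origin k<n))) refl
            (trans (sym (isometry y (flip n i (chain 0)))) (cong₂ (dist n) fy p)))))

    identity : ∀ x → f x ≡ x
    identity x = bit-injective n λ i i<n → bit-from-dist n i i i<n i<n refl
      (isometry-to-fixed x origin-fixed) (isometry-to-fixed x (neighbour-fixed i i<n))

  -- The red coloring and the size of its red class.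

  -- One list serves twice: membership in it decides redness, and its length bounds the red class.
  redEdges : List (Vₙ × Vₙ)
  redEdges = map (λ w → chain w , flip n w (chain w)) (upTo (2 + L)) ++
    (chain 0 , flip n 1 (chain 0)) ∷ (chain 0 , flip n 2 (chain 0)) ∷
    map (λ j → row j , flip n (suc L) (row j)) (upTo L)

  length-redEdges : length redEdges ≡ (2 + L) + (2 + L)
  length-redEdges = trans (length-++ (map _ (upTo (2 + L))))
    (cong₂ (λ a b → a + (2 + b)) (trans (length-map _ (upTo (2 + L))) (length-upTo (2 + L)))
      (trans (length-map _ (upTo L)) (length-upTo L)))

  ∈⇒up : ∀ {x y} → (x , y) ∈ redEdges → Up x y
  ∈⇒up e with ∈-++⁻ (map _ (upTo (2 + L))) e
  ... | inj₁ p with w , w∈ , refl ← ∈-map⁻ _ p = w , chainᵉ (∈-upTo⁻ w∈) , refl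
  ... | inj₂ (here refl)         = 1 , spokeᵉ ≤-refl (s≤s z≤n) , refl
  ... | inj₂ (there (here refl)) = 2 , spokeᵉ (s≤s z≤n) ≤-refl , refl
  ... | inj₂ (there (there p)) with j , j∈ , refl ← ∈-map⁻ _ p = suc L , rowᵉ (∈-upTo⁻ j∈) , refl

  up⇒∈ : ∀ {x y} → Up x y → (x , y) ∈ redEdges
  up⇒∈ (_ , chainᵉ w<    , refl) = ∈-++⁺ˡ (∈-map⁺ _ (∈-upTo⁺ w<))
  up⇒∈ (1 , spokeᵉ _ _   , refl) = ∈-++⁺ʳ (map _ (upTo (2 + L))) (here refl)
  up⇒∈ (2 , spokeᵉ _ _   , refl) = ∈-++⁺ʳ (map _ (upTo (2 + L))) (there (here refl))
  up⇒∈ (suc (suc (suc _)) , spokeᵉ _ (s≤s (s≤s ())) , _)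
  up⇒∈ (_ , rowᵉ j<L     , refl) =
    ∈-++⁺ʳ (map _ (upTo (2 + L))) (there (there (∈-map⁺ _ (∈-upTo⁺ j<L))))

  redEdge? : ∀ x y → Dec (RedEdge x y)
  redEdge? x y = map′ (Sum.map ∈⇒up ∈⇒up) (Sum.map up⇒∈ up⇒∈) ((x , y) ∈? redEdges ⊎-dec (y , x) ∈? redEdges)
    where open DecMembership (≡-dec (Graph._≟ᵛ_ (Q n)) (Graph._≟ᵛ_ (Q n))) using (_∈?_)

  redColor : Vₙ → Vₙ → Fin 2
  redColor x y = if does (redEdge? x y) then zero else suc zero

  redEdge⇒zero : ∀ {x y} → RedEdge x y → redColor x y ≡ zero
  redEdge⇒zero {x} {y} e = cong (if_then zero else suc zero) (dec-true (redEdge? x y) e)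

  zero⇒redEdge : ∀ {x y} → redColor x y ≡ zero → RedEdge x y
  zero⇒redEdge {x} {y} eq = decidable-stable (redEdge? x y) λ ¬e → contradiction
    (trans (sym eq) (cong (if_then zero else suc zero) (dec-false (redEdge? x y) ¬e))) λ ()

  redColor-sym : ∀ x y → redColor x y ≡ redColor y x
  redColor-sym x y = cong (if_then zero else suc zero)
    (does-⇔ (mk⇔ Sum.swap Sum.swap) (redEdge? x y) (redEdge? y x))

  redColoring : EdgeColoring (Q n) 2
  redColoring = record { color = redColor ; color-sym = λ {x} {y} _ → redColor-sym x y }

  redColoring-distinguishing : Distinguishing redColoring
  redColoring-distinguishing f preserves = Fixing.identity to from
    strictlyInverseʳ strictlyInverseˡ
    (Equivalence.to (preserves-adj _ _))
    (λ {x} {y} e → Equivalence.from (preserves-adj (from x) (from y))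
      (subst₂ (Adj (Q n)) (sym (strictlyInverseˡ x)) (sym (strictlyInverseˡ y)) e))
    (λ e → zero⇒redEdge (trans (preserves (redEdge-Adj e)) (redEdge⇒zero e)))
    where
    open Automorphism f
    open Inverse bijection using (strictlyInverseʳ; strictlyInverseˡ)

  redColoring-size : smallerClassSize redColoring ≤ (2 + L) + (2 + L)
  redColoring-size = begin
    smallerClassSize redColoring  ≤⟨ m⊓n≤m (classSize redColoring zero) _ ⟩
    classSize redColoring zero    ≤⟨ classSize-≤ redColoring zero redEdges (Sum.map up⇒∈ up⇒∈ ∘ zero⇒redEdge) ⟩
    length redEdges               ≡⟨ length-redEdges ⟩
    (2 + L) + (2 + L)             ∎
    where open ≤-Reasoning

-- One color does not suffice.

flip-first-hom : ∀ n {x y} → Adj (Q n) x y → Adj (Q n) (flip n 0 x) (flip n 0 y)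
flip-first-hom zero    e                 = e
flip-first-hom (suc n) (inj₁ (refl , e)) = inj₁ (refl , e)
flip-first-hom (suc n) {a , _} {b , _} (inj₂ (a≢b , refl)) = inj₂ (a≢b ∘ opposite-injective , refl)
  where
  opposite-injective : opposite a ≡ opposite b → a ≡ b
  opposite-injective eq =
    trans (sym (opposite₂-involutive a)) (trans (cong opposite eq) (opposite₂-involutive b))

module _ (n : ℕ) (0<n : 0 < n) where

  flip-first-automorphism : Automorphism (Q n)
  flip-first-automorphism = record
    { bijection     = mk↔ₛ′ (flip n 0) (flip n 0) (flip-involutive n 0) (flip-involutive n 0)
    ; preserves-adj = λ x y → mk⇔ (flip-first-hom n) λ e →
        subst₂ (Adj (Q n)) (flip-involutive n 0 x) (flip-involutive n 0 y) (flip-first-hom n e)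
    }

  -- No color exists in `Fin 0`. With a single color every automorphism preserves the coloring, and
  -- flipping the first coordinate moves each vertex to a neighbour.
  2≤distinguishing : ∀ k → Σ[ c ∈ EdgeColoring (Q n) k ] Distinguishing c → 2 ≤ k
  2≤distinguishing 0 (c , _) with () ← color c (vertex n λ _ → false) (vertex n λ _ → false)
  2≤distinguishing 1 (c , distinguishing) = contradiction
    (subst (Adj (Q n) x) (distinguishing flip-first-automorphism (λ _ → Fin1-irrelevant _ _) x) (flip-Adj n 0 x 0<n))
    (Graph.adj-irr (Q n))
    where
    x : V (Q n)
    x = vertex n λ _ → false
    Fin1-irrelevant : ∀ (a b : Fin 1) → a ≡ b
    Fin1-irrelevant zero zero = refl
  2≤distinguishing (suc (suc k)) _ = s≤s (s≤s z≤n)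

-- Estimates for the logarithm and the final inequality.

-- Monotonicity suffices because `⌈log₂ 5 ⌉` computes to 3.
3≤⌈log₂n⌉ : ∀ {n} → 5 ≤ n → 3 ≤ ⌈log₂ n ⌉
3≤⌈log₂n⌉ = ⌈log₂⌉-mono-≤

-- With `n = 2 + m` this follows from `2 + m ≤ 2 ^ m`, which holds from `m = 2` on, with equality
-- there.
2+⌈log₂n⌉≤n : ∀ {n} → 4 ≤ n → 2 + ⌈log₂ n ⌉ ≤ n
2+⌈log₂n⌉≤n {suc (suc m)} (s≤s (s≤s 2≤m)) = s≤s (s≤s (begin
  ⌈log₂ 2 + m ⌉    ≤⟨ ⌈log₂⌉-mono-≤ (2+m≤2^m 2≤m) ⟩
  ⌈log₂ (2 ^ m) ⌉  ≡⟨ ⌈log₂2^n⌉≡n m ⟩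
  m                ∎))
  where
  open ≤-Reasoning
  2+m≤2^m : ∀ {m} → 2 ≤ m → 2 + m ≤ 2 ^ m
  2+m≤2^m {suc zero}          (s≤s ())
  2+m≤2^m {suc (suc zero)}    _ = ≤-refl
  2+m≤2^m {suc (suc (suc m))} _ with ih ← 2+m≤2^m {2 + m} (s≤s (s≤s z≤n)) =
    ≤-trans (s≤s ih) (≤-trans (+-monoˡ-≤ (2 ^ (2 + m)) (m^n>0 2 (2 + m)))
      (+-monoʳ-≤ (2 ^ (2 + m)) (≤-reflexive (sym (+-identityʳ _)))))

theorem5p9 : ∀ (n : ℕ) → 5 ≤ n →
    ∃[ k ] (IsCost (Q n) k × 2 * k ≤ (⌈log₂ n ⌉ + 4) * (⌈log₂ n ⌉ + 1))
theorem5p9 n 5≤n =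
  let k , k≤size , minimum = least (attains? (Q n)) (redColoring , redColoring-distinguishing , refl)
  in k , record
       { index≡2 = (redColoring , redColoring-distinguishing) , 2≤distinguishing n (≤-trans (s≤s z≤n) 5≤n)
       ; minimum = minimum
       } , (begin
    2 * k                      ≤⟨ *-monoʳ-≤ 2 (≤-trans k≤size redColoring-size) ⟩
    2 * ((2 + L) + (2 + L))    ≡⟨ solve 1 (λ l → con 2 :* ((con 2 :+ l) :+ (con 2 :+ l)) := (l :+ con 2) :* con 4) refl L ⟩
    -- The linear count fits under the quadratic bound factor by factor: `2 ≤ 4`, and `4 ≤ L + 1`
    -- because `3 ≤ L`.
    (L + 2) * 4                ≤⟨ *-mono-≤ (+-monoʳ-≤ L {2} {4} (s≤s (s≤s z≤n))) (+-monoˡ-≤ 1 3≤L) ⟩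
    (L + 4) * (L + 1)          ∎)
  where
  L : ℕ
  L = ⌈log₂ n ⌉
  3≤L : 3 ≤ L
  3≤L = 3≤⌈log₂n⌉ 5≤n
  open Pattern n L 3≤L (2+⌈log₂n⌉≤n (≤-trans (n≤1+n 4) 5≤n)) (n≤2^⌈log₂n⌉ n)
  open ≤-Reasoning
  open +-*-Solver
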